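{- Let $q>2$ be a prime power, let $\mathbb{F}_q[x]$ be the ring of polynomials over the finite field $\mathbb{F}_q$, and let $R$ be a quotient ring of $\mathbb{F}_q[x]$ with $R\neq 0$ and $R\neq \mathbb{F}_q[x]$. Let $\mathcal{S}_R$ denote the multiplicative semigroup of $R$ and $U(\mathcal{S}_R)$ its group of units. Then $\mathrm{D}(\mathcal{S}_R)=\mathrm{D}(U(\mathcal{S}_R))$.
   Context: For a commutative semigroup $\mathcal{S}$ (written additively, operation $+$; here the operation is ring multiplication), a sequence $T=a_1\cdot a_2\cdot\ldots\cdot a_\ell$ of elements of $\mathcal{S}$ (a finite unordered multiset, repetitions allowed) has sum $\sigma(T)=a_1+\cdots+a_\ell$. If $\mathcal{S}$ has an identity $0_{\mathcal{S}}$, the empty sequence is allowed as a subsequence with sum $0_{\mathcal{S}}$. $T$ is called reducible if it has a proper subsequence $T'\neq T$ (possibly empty, when $\mathcal{S}$ has an identity) with $\sigma(T')=\sigma(T)$. The Davenport constant $\mathrm{D}(\mathcal{S})$ is the smallest $\ell\in\mathbb{N}\cup\{\infty\}$ such that every sequence of elements of $\mathcal{S}$ of length at least $\ell$ is reducible. For a finite abelian group $G$ this coincides with the classical Davenport constant: the least $\ell$ such that every sequence of length at least $\ell$ in $G$ has a nonempty subsequence summing to the identity. The group of units $U(\mathcal{S})$ is the set of elements $a$ with $a+a'=0_{\mathcal{S}}$ for some $a'\in\mathcal{S}$. -}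

module Defs where

open import Level using (Level; _⊔_)
open import Algebra.Bundles using (CommutativeRing)
open import Data.Nat using (ℕ; suc; _<_; _≤_; _^_)
open import Data.Nat.Primality using (Prime)
open import Data.Fin using (Fin)
open import Data.List using (List; []; _∷_; length; foldr; map)
open import Data.List.Relation.Unary.All using (All)
open import Data.List.Relation.Binary.Sublist.Propositional using (_⊆_)
open import Data.Product using (Σ; ∃; _×_; _,_)
open import Relation.Nullary using (¬_)
open import Relation.Binary.PropositionalEquality using (_≡_)

IsPrimePower : ℕ → Set
IsPrimePower q = Σ ℕ λ p → Σ ℕ λ k → Prime p × q ≡ p ^ suc k

record FiniteField (c ℓ : Level) (q : ℕ) : Set (Level.suc (c ⊔ ℓ)) where
  field
    cring : CommutativeRing c ℓ
  open CommutativeRing cring public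
  field
    0≉1       : ¬ (0# ≈ 1#)
    inverse   : ∀ x → ¬ (x ≈ 0#) → ∃ λ y → (x * y) ≈ 1#
    enum      : Fin q → Carrier
    enum-surj : ∀ x → ∃ λ i → enum i ≈ x
    enum-inj  : ∀ i j → enum i ≈ enum j → i ≡ j

-- Polynomials over a commutative ring, as coefficient lists (constant term first),
-- and the quotient ring F[x]/(f) as a setoid of polynomials modulo f.
module Poly {c ℓ} (K : CommutativeRing c ℓ) where
  open CommutativeRing K

  Pol : Set c
  Pol = List Carrier

  _⊕_ : Pol → Pol → Pol
  [] ⊕ q = q
  (a ∷ p) ⊕ [] = a ∷ p
  (a ∷ p) ⊕ (b ∷ q) = (a + b) ∷ (p ⊕ q)

  neg : Pol → Pol
  neg = map (λ x → - x)

  scale : Carrier → Pol → Pol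
  scale a = map (a *_)

  _⊗_ : Pol → Pol → Pol
  [] ⊗ q = []
  (a ∷ p) ⊗ q = scale a q ⊕ (0# ∷ (p ⊗ q))

  zeroP : Pol
  zeroP = []

  oneP : Pol
  oneP = 1# ∷ []

  IsZero : Pol → Set (c ⊔ ℓ)
  IsZero = All (_≈ 0#)

  _∣ₚ_ : Pol → Pol → Set (c ⊔ ℓ)
  f ∣ₚ g = ∃ λ h → IsZero ((f ⊗ h) ⊕ neg g)

  EqMod : Pol → Pol → Pol → Set (c ⊔ ℓ)
  EqMod f a b = f ∣ₚ (a ⊕ neg b)

  IsUnitMod : Pol → Pol → Set (c ⊔ ℓ)
  IsUnitMod f a = ∃ λ b → EqMod f (a ⊗ b) oneP

-- Davenport constant of a (sub)semigroup with identity e of a commutative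
-- semigroup (A, ·) with equality ≈; the subsemigroup is given by a predicate P
-- (P = everything for the whole semigroup). Sequences are lists (order irrelevant
-- by commutativity), subsequences are sublists.
module Davenport {a r} {A : Set a} (_≈_ : A → A → Set r) (_·_ : A → A → A) (e : A) where

  σ : List A → A
  σ = foldr _·_ e

  Reducible : List A → Set (a ⊔ r)
  Reducible T = ∃ λ T' → T' ⊆ T × length T' < length T × σ T' ≈ σ T

  AllReducibleFrom : ∀ {p} → (A → Set p) → ℕ → Set (a ⊔ r ⊔ p)
  AllReducibleFrom P n = ∀ T → All P T → n ≤ length T → Reducible T

  IsDavenport : ∀ {p} → (A → Set p) → ℕ → Set (a ⊔ r ⊔ p)
  IsDavenport P n = AllReducibleFrom P n × (∀ m → m < n → ¬ AllReducibleFrom P m)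

{-# OPTIONS --safe #-}
-- If every sequence of n units mod f is reducible, then so is every sequence T of length ≥ n.
-- This is clear when all terms of T are coprime to f. Otherwise some term a shares a nonconstant
-- factor g with f = g f'. The map U(F[x]/f) → U(F[x]/f') is surjective, and since q > 2 its kernel is
-- nontrivial, so D(U(F[x]/f')) ≤ D(U(F[x]/f)) − 1 ≤ n − 1. By induction on the length, T without a
-- is reducible mod f'; as f divides a f', multiplying by a gives a reduction of T mod f.
module Submission where

open import Defs
open import Algebra.Bundles using (AbelianGroup; CommutativeRing; RawGroup)
open import Algebra.Structures using (IsAbelianGroup)
open import Data.Empty using (⊥-elim)
open import Data.Fin using (Fin; zero; suc)
open import Data.List using (List; []; _∷_; foldr; length)
open import Data.List.Relation.Binary.Pointwise using (Pointwise; []; _∷_)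
open import Data.List.Relation.Binary.Sublist.Heterogeneous.Properties using (toPointwise)
open import Data.List.Relation.Binary.Sublist.Propositional using (_⊆_; []; _∷_; _∷ʳ_)
open import Data.List.Relation.Unary.All using (All; []; _∷_; decide; universal)
open import Data.List.Relation.Unary.Any using (Any; here; there)
open import Data.Nat using (ℕ; zero; suc; s≤s; z≤n; _<_)
open import Data.Product using (∃; ∃₂; _×_; _,_; map₂)
open import Data.Sum using (_⊎_; inj₁; inj₂)
open import Data.Unit.Polymorphic using (⊤; tt)
open import Function.Bundles using (_⇔_; mk⇔)
open import Level using (Level; _⊔_)
open import Relation.Binary.PropositionalEquality using (_≡_; _≢_)
open import Relation.Nullary using (¬_; Dec; yes; no)
import Algebra.Construct.Pointwise as PointwiseConstruct
import Algebra.Morphism.GroupMonomorphism as GroupMonomorphism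
import Algebra.Properties.AbelianGroup as AbelianGroupProperties
import Algebra.Properties.CommutativeSemigroup as CommutativeSemigroupProperties
import Algebra.Properties.Ring as RingProperties
import Algebra.Properties.Semiring.Divisibility as SemiringDivisibility
import Algebra.Solver.Ring.NaturalCoefficients.Default as NaturalCoefficients
import Data.Fin as Fin
import Data.List.Relation.Binary.Pointwise as Pointwise
import Data.List.Relation.Unary.All as All
import Data.Nat as ℕ
import Data.Nat.Properties as ℕ
import Relation.Binary.PropositionalEquality as ≡
import Relation.Binary.Reasoning.Setoid as SetoidReasoning

-- The step that needs `q > 2` is the nontrivial kernel. Over the field with two elements take f =
-- x(x+1): the only unit modulo f is 1, so its group of units has Davenport constant 1, yet the
-- sequence x, x+1 is irreducible. Removing x leaves the modulus x+1, and the unit group does not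
-- shrink. For `q > 2` there is a constant `e` with `e` and 1 + `e` both nonzero, and 1 + `e` is
-- then a unit different from 1 in every nonzero quotient. No factorisation into primes is used,
-- only greatest common divisors. The price is that `g` and the cofactor `f'` may share factors, so
-- the Chinese remainder theorem does not apply to f = g f'. Hence the two cases in
-- `kernel-element`, and hence the surjectivity on units rests on `coprimePart` instead of a
-- decomposition of the quotient ring.

module Modular {c ℓ} (R : CommutativeRing c ℓ) where
  open CommutativeRing R
  open SemiringDivisibility semiring using (_∣_; _,_)
  open NaturalCoefficients commutativeSemiring using (solve; _:=_; _:+_; _:*_)
  open RingProperties ring using (+-cancelˡ)
  open AbelianGroupProperties +-abelianGroup using (xyx⁻¹≈y)
  open SetoidReasoning setoid

  -- Congruences, coprimality and Bézout identities in a commutative ring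

  infix 4 _≈[_]_ _⟂_

  -- Stated without subtraction, so that calculations with congruences become semiring identities
  -- within reach of `solve`. The difference form used by `EqMod` is recovered by `-⇒≈mod` and
  -- `≈mod⇒-`.
  _≈[_]_ : Carrier → Carrier → Carrier → Set (c ⊔ ℓ)
  x ≈[ f ] y = ∃ λ h → x ≈ y + f * h

  -- A Bézout identity: `u` is an inverse of `a` modulo `b`, so `_⟂ f` plays the role of the
  -- predicate of being a unit modulo `f`.
  _⟂_ : Carrier → Carrier → Set (c ⊔ ℓ)
  a ⟂ b = ∃₂ λ u v → a * u + b * v ≈ 1#

  module _ {f : Carrier} where

    ≈⇒≈mod : ∀ {x y} → x ≈ y → x ≈[ f ] y
    ≈⇒≈mod {x} {y} x≈y = 0# , (begin
      x           ≈⟨ x≈y ⟩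
      y           ≈⟨ +-identityʳ y ⟨
      y + 0#      ≈⟨ +-congˡ (zeroʳ f) ⟨
      y + f * 0#  ∎)

    ≈mod-sym : ∀ {x y} → x ≈[ f ] y → y ≈[ f ] x
    ≈mod-sym {x} {y} (h , x≈y+fh) = - h , (begin
      y                            ≈⟨ +-identityʳ y ⟨
      y + 0#                       ≈⟨ +-congˡ (zeroʳ f) ⟨
      y + f * 0#                   ≈⟨ +-congˡ (*-congˡ (-‿inverseʳ h)) ⟨
      y + f * (h + - h)            ≈⟨ solve 4 (λ y f h h' → y :+ f :* (h :+ h') := (y :+ f :* h) :+ f :* h') refl y f h (- h) ⟩
      (y + f * h) + f * - h        ≈⟨ +-congʳ x≈y+fh ⟨
      x + f * - h                  ∎)

    ≈mod-trans : ∀ {x y z} → x ≈[ f ] y → y ≈[ f ] z → x ≈[ f ] z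
    ≈mod-trans {x} {y} {z} (h , x≈y+fh) (k , y≈z+fk) = k + h , (begin
      x                    ≈⟨ x≈y+fh ⟩
      y + f * h            ≈⟨ +-congʳ y≈z+fk ⟩
      (z + f * k) + f * h  ≈⟨ solve 4 (λ z f k h → (z :+ f :* k) :+ f :* h := z :+ f :* (k :+ h)) refl z f k h ⟩
      z + f * (k + h)      ∎)

    ≈mod-*-cong : ∀ {x y z w} → x ≈[ f ] y → z ≈[ f ] w → x * z ≈[ f ] y * w
    ≈mod-*-cong {x} {y} {z} {w} (h , x≈y+fh) (k , z≈w+fk) = y * k + h * (w + f * k) , (begin
      x * z                                      ≈⟨ *-cong x≈y+fh z≈w+fk ⟩
      (y + f * h) * (w + f * k)                  ≈⟨ solve 5 (λ y w f h k → (y :+ f :* h) :* (w :+ f :* k) := y :* w :+ f :* (y :* k :+ h :* (w :+ f :* k))) refl y w f h k ⟩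
      y * w + f * (y * k + h * (w + f * k))      ∎)

    *-cancelˡ-mod : ∀ {a x y} → a ⟂ f → a * x ≈[ f ] a * y → x ≈[ f ] y
    *-cancelˡ-mod {a} {x} {y} (u , v , au+fv≈1) ax≈ay =
      ≈mod-trans (expand x) (≈mod-trans (≈mod-*-cong (≈⇒≈mod refl) ax≈ay) (≈mod-sym (expand y)))
      where
      expand : ∀ z → z ≈[ f ] u * (a * z)
      expand z = v * z , (begin
        z                              ≈⟨ *-identityˡ z ⟨
        1# * z                         ≈⟨ *-congʳ au+fv≈1 ⟨
        (a * u + f * v) * z            ≈⟨ solve 5 (λ a u f v z → (a :* u :+ f :* v) :* z := u :* (a :* z) :+ f :* (v :* z)) refl a u f v z ⟩
        u * (a * z) + f * (v * z)      ∎)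

  ≈mod-∣ : ∀ {d f x y} → d ∣ f → x ≈[ f ] y → x ≈[ d ] y
  ≈mod-∣ {d} {f} {x} {y} (q , qd≈f) (h , x≈y+fh) = q * h , (begin
    x                 ≈⟨ x≈y+fh ⟩
    y + f * h         ≈⟨ +-congˡ (*-congʳ qd≈f) ⟨
    y + (q * d) * h   ≈⟨ solve 4 (λ y q d h → y :+ (q :* d) :* h := y :+ d :* (q :* h)) refl y q d h ⟩
    y + d * (q * h)   ∎)

  -- This carries a reduction modulo the cofactor back to `f`: multiplied by `a`, the error term
  -- `d * h` becomes a multiple of `a * d`, hence of `f`.
  *-scale-mod : ∀ {f d a x y} → f ∣ a * d → x ≈[ d ] y → a * x ≈[ f ] a * y
  *-scale-mod {f} {d} {a} {x} {y} (q , qf≈ad) (h , x≈y+dh) = q * h , (begin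
    a * x                   ≈⟨ *-congˡ x≈y+dh ⟩
    a * (y + d * h)         ≈⟨ solve 4 (λ a y d h → a :* (y :+ d :* h) := a :* y :+ (a :* d) :* h) refl a y d h ⟩
    a * y + (a * d) * h     ≈⟨ +-congˡ (*-congʳ qf≈ad) ⟨
    a * y + (q * f) * h     ≈⟨ solve 4 (λ z q f h → z :+ (q :* f) :* h := z :+ f :* (q :* h)) refl (a * y) q f h ⟩
    a * y + f * (q * h)     ∎)

  ⟂-sym : ∀ {a b} → a ⟂ b → b ⟂ a
  ⟂-sym (u , v , eq) = v , u , trans (+-comm _ _) eq

  ⟂-∣ : ∀ {a b c} → c ∣ b → a ⟂ b → a ⟂ c
  ⟂-∣ {a} {b} {c} (q , qc≈b) (u , v , eq) = u , q * v , (begin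
    a * u + c * (q * v)  ≈⟨ solve 5 (λ a u c q v → a :* u :+ c :* (q :* v) := a :* u :+ (q :* c) :* v) refl a u c q v ⟩
    a * u + (q * c) * v  ≈⟨ +-congˡ (*-congʳ qc≈b) ⟩
    a * u + b * v        ≈⟨ eq ⟩
    1#                   ∎)

  -- Multiply the two Bézout identities; every term of the product except `b * v * (c * v')` is a
  -- multiple of `a`.
  ⟂-* : ∀ {a b c} → a ⟂ b → a ⟂ c → a ⟂ b * c
  ⟂-* {a} {b} {c} (u , v , eq) (u' , v' , eq') = u * (a * u' + c * v') + b * v * u' , v * v' , (begin
    a * (u * (a * u' + c * v') + b * v * u') + b * c * (v * v')  ≈⟨ solve 7 (λ a u u' c v' b v → a :* (u :* (a :* u' :+ c :* v') :+ b :* v :* u') :+ b :* c :* (v :* v') := (a :* u :+ b :* v) :* (a :* u' :+ c :* v')) refl a u u' c v' b v ⟩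
    (a * u + b * v) * (a * u' + c * v')                          ≈⟨ *-cong eq eq' ⟩
    1# * 1#                                                      ≈⟨ *-identityˡ 1# ⟩
    1#                                                           ∎)

  ⟂-resp-≈mod : ∀ {f x y} → x ≈[ f ] y → y ⟂ f → x ⟂ f
  ⟂-resp-≈mod {f} {x} {y} x≈y (u , v , eq) = let h , y≈x+fh = ≈mod-sym x≈y in u , h * u + v , (begin
    x * u + f * (h * u + v)   ≈⟨ solve 5 (λ x u f h v → x :* u :+ f :* (h :* u :+ v) := (x :+ f :* h) :* u :+ f :* v) refl x u f h v ⟩
    (x + f * h) * u + f * v   ≈⟨ +-congʳ (*-congʳ y≈x+fh) ⟨
    y * u + f * v             ≈⟨ eq ⟩
    1#                        ∎)

  1⟂ : ∀ {f} → 1# ⟂ f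
  1⟂ {f} = 1# , 0# , trans (+-cong (*-identityˡ 1#) (zeroʳ f)) (+-identityʳ 1#)

  -⇒≈mod : ∀ {f h x y} → f * h ≈ x - y → x ≈[ f ] y
  -⇒≈mod {f} {h} {x} {y} fh≈x-y = h , (begin
    x              ≈⟨ xyx⁻¹≈y y x ⟨
    y + x - y      ≈⟨ +-assoc y x (- y) ⟩
    y + (x - y)    ≈⟨ +-congˡ fh≈x-y ⟨
    y + f * h      ∎)

  ≈mod⇒- : ∀ {f x y} → x ≈[ f ] y → ∃ λ h → f * h ≈ x - y
  ≈mod⇒- {f} {x} {y} (h , x≈y+fh) = h , (begin
    f * h              ≈⟨ xyx⁻¹≈y y (f * h) ⟨
    y + f * h - y      ≈⟨ +-congʳ x≈y+fh ⟨
    x - y              ∎)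

  ⟂⇒unitMod : ∀ {f a} → a ⟂ f → ∃ λ b → a * b ≈[ f ] 1#
  ⟂⇒unitMod (u , v , au+fv≈1) = u , ≈mod-sym (v , sym au+fv≈1)

  Bézout : Carrier → Carrier → Carrier → Set (c ⊔ ℓ)
  Bézout a b g = g ∣ a × g ∣ b × ∃₂ λ u v → a * u + b * v ≈ g

  bézout-zero : ∀ {a b} → b ≈ 0# → Bézout a b a
  bézout-zero {a} {b} b≈0 =
    (1# , *-identityˡ a) , (0# , trans (zeroˡ a) (sym b≈0)) , 1# , 0# ,
    trans (+-cong (*-identityʳ a) (zeroʳ b)) (+-identityʳ a)

  bézout-step : ∀ {a b q r g} → a ≈ b * q + r → Bézout b r g → Bézout a b g
  bézout-step {a} {b} {q} {r} {g} a≈bq+r ((s , sg≈b) , (t , tg≈r) , u , v , bu+rv≈g) =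
    -- The new coefficients come from substituting r = a - b q in b u + r v.
    (s * q + t , g∣a) , (s , sg≈b) , v , u + q * - v , (begin
      a * v + b * (u + q * - v)                ≈⟨ +-congʳ (*-congʳ a≈bq+r) ⟩
      (b * q + r) * v + b * (u + q * - v)      ≈⟨ solve 6 (λ b q r v u v' → (b :* q :+ r) :* v :+ b :* (u :+ q :* v') := (b :* u :+ r :* v) :+ b :* q :* (v :+ v')) refl b q r v u (- v) ⟩
      (b * u + r * v) + b * q * (v + - v)      ≈⟨ +-cong bu+rv≈g (trans (*-congˡ (-‿inverseʳ v)) (zeroʳ (b * q))) ⟩
      g + 0#                                   ≈⟨ +-identityʳ g ⟩
      g                                        ∎)
    where
    g∣a : (s * q + t) * g ≈ a
    g∣a = begin
      (s * q + t) * g        ≈⟨ solve 4 (λ s q t g → (s :* q :+ t) :* g := (s :* g) :* q :+ t :* g) refl s q t g ⟩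
      (s * g) * q + t * g    ≈⟨ +-cong (*-congʳ sg≈b) tg≈r ⟩
      b * q + r              ≈⟨ a≈bq+r ⟨
      a                      ∎

  bézout-unit : ∀ {a b g w} → g * w ≈ 1# → Bézout a b g → a ⟂ b
  bézout-unit {a} {b} {g} {w} gw≈1 (_ , _ , u , v , au+bv≈g) = u * w , v * w , (begin
    a * (u * w) + b * (v * w)  ≈⟨ solve 5 (λ a u w b v → a :* (u :* w) :+ b :* (v :* w) := (a :* u :+ b :* v) :* w) refl a u w b v ⟩
    (a * u + b * v) * w        ≈⟨ *-congʳ au+bv≈g ⟩
    g * w                      ≈⟨ gw≈1 ⟩
    1#                         ∎)

  -- Sequences and their products modulo an element

  open module DavenportMod (f : Carrier) = Davenport (_≈[ f ]_) _*_ 1# public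
    using (Reducible; AllReducibleFrom)

  -- In a domain with `f` nonzero, `¬ (f ∣ f')` says that `g` is not a unit. This form avoids
  -- degrees and is the hypothesis that `kernel-element` consumes.
  ProperCofactor : Carrier → Carrier → Carrier → Set (c ⊔ ℓ)
  ProperCofactor a f f' = ∃ λ g → f ≈ g * f' × g ∣ a × ¬ (f ∣ f')

  ∏ : List Carrier → Carrier
  ∏ = foldr _*_ 1#

  ∏-cong-mod : ∀ {f T S} → Pointwise (_≈[ f ]_) T S → ∏ T ≈[ f ] ∏ S
  ∏-cong-mod [] = ≈⇒≈mod refl
  ∏-cong-mod (x≈y ∷ eqs) = ≈mod-*-cong x≈y (∏-cong-mod eqs)

  ∏-⟂ : ∀ {f T} → All (_⟂ f) T → ∏ T ⟂ f
  ∏-⟂ [] = 1⟂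
  ∏-⟂ (a⟂f ∷ T⟂f) = ⟂-sym (⟂-* (⟂-sym a⟂f) (⟂-sym (∏-⟂ T⟂f)))

  ⊆-Pointwise : ∀ {f T T' S} → Pointwise (_≈[ f ]_) T S → T' ⊆ T →
                ∃ λ S' → S' ⊆ S × Pointwise (_≈[ f ]_) T' S'
  ⊆-Pointwise [] [] = [] , [] , []
  ⊆-Pointwise (_ ∷ eqs) (_ ∷ʳ sub) with ⊆-Pointwise eqs sub
  ... | S' , sub' , eqs' = S' , _ ∷ʳ sub' , eqs'
  ⊆-Pointwise (x≈y ∷ eqs) (≡.refl ∷ sub) with ⊆-Pointwise eqs sub
  ... | S' , sub' , eqs' = _ ∷ S' , ≡.refl ∷ sub' , x≈y ∷ eqs'

  reducible-resp-≈mod : ∀ {f T S} → Pointwise (_≈[ f ]_) T S → Reducible f T → Reducible f S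
  reducible-resp-≈mod eqs (T' , sub , len , ∏T'≈∏T) with ⊆-Pointwise eqs sub
  ... | S' , sub' , eqs' =
    S' , sub' , ≡.subst₂ ℕ._<_ (Pointwise.Pointwise-length eqs') (Pointwise.Pointwise-length eqs) len ,
    ≈mod-trans (≈mod-sym (∏-cong-mod eqs')) (≈mod-trans ∏T'≈∏T (∏-cong-mod eqs))

  -- `_⊆_` respects order, so the chosen term cannot simply be moved to the front. The last
  -- component puts it back at its own place in any sublist of the remainder.
  extract : ∀ {p} {Q : Carrier → Set p} {T} → Any Q T →
    ∃₂ λ a T₀ → Q a × length T ≡ suc (length T₀) × ∏ T ≈ a * ∏ T₀ ×
    (∀ {T'} → T' ⊆ T₀ → ∃ λ T⁺ → T⁺ ⊆ T × length T⁺ ≡ suc (length T') × ∏ T⁺ ≈ a * ∏ T')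
  extract {T = a ∷ T} (here qa) =
    a , T , qa , ≡.refl , refl , λ {T'} sub → a ∷ T' , ≡.refl ∷ sub , ≡.refl , refl
  extract {T = x ∷ T} (there any) with extract any
  ... | a , T₀ , qa , len , ∏T≈a∏T₀ , insert =
    a , x ∷ T₀ , qa , ≡.cong suc len , x*-swap ∏T≈a∏T₀ , insert'
    where
    x*-swap : ∀ {y z} → y ≈ a * z → x * y ≈ a * (x * z)
    x*-swap {y} {z} y≈az = trans (*-congˡ y≈az)
      (solve 3 (λ x a z → x :* (a :* z) := a :* (x :* z)) refl x a z)

    insert' : ∀ {T'} → T' ⊆ x ∷ T₀ →
              ∃ λ T⁺ → T⁺ ⊆ x ∷ T × length T⁺ ≡ suc (length T') × ∏ T⁺ ≈ a * ∏ T'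
    insert' (_ ∷ʳ sub) with insert sub
    ... | T⁺ , sub⁺ , len⁺ , eq⁺ = T⁺ , x ∷ʳ sub⁺ , len⁺ , eq⁺
    insert' (≡.refl ∷ sub) with insert sub
    ... | T⁺ , sub⁺ , len⁺ , eq⁺ = x ∷ T⁺ , ≡.refl ∷ sub⁺ , ≡.cong suc len⁺ , x*-swap eq⁺

  -- Lifting units, and the induction on the length

  -- The hypotheses hold in F[x] for a field F; degree< serves only as a termination measure.
  module _
    (degree< : ℕ → Carrier → Set ℓ)
    (degree<0⇒≈0 : ∀ {f} → degree< 0 f → f ≈ 0#)
    (degree-bound : ∀ f → ∃ λ n → degree< n f)
    (cancelˡ : ∀ {d x y} → ¬ (d ≈ 0#) → d * x ≈ d * y → x ≈ y)
    (coprime-or-cofactor : ∀ a f → ¬ (f ≈ 0#) →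
      a ⟂ f ⊎ (∃ λ f' → ProperCofactor a f f' × (∀ n → degree< (suc n) f → degree< n f')))
    where

    -- t is the part of f that remains after removing all factors shared with a.
    coprimePart : ∀ n a f → degree< n f → ¬ (f ≈ 0#) →
      ∃ λ t → t ⟂ a × (∀ x → x ⟂ t → x ⟂ a → x ⟂ f)
    coprimePart zero a f deg f≉0 = ⊥-elim (f≉0 (degree<0⇒≈0 deg))
    coprimePart (suc n) a f deg f≉0 with coprime-or-cofactor a f f≉0
    ... | inj₁ a⟂f = f , ⟂-sym a⟂f , λ x x⟂f _ → x⟂f
    ... | inj₂ (f' , (g , f≈gf' , g∣a , _) , deg')
        with coprimePart n a f' (deg' n deg) (λ f'≈0 → f≉0 (trans f≈gf' (trans (*-congˡ f'≈0) (zeroʳ g))))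
    ...   | t , t⟂a , coprime = t , t⟂a , λ x x⟂t x⟂a →
            ⟂-∣ (1# , trans (*-identityˡ f) f≈gf') (⟂-* (⟂-∣ g∣a x⟂a) (coprime x x⟂t x⟂a))

    -- Surjectivity on units. The lift `a + d * t` is `a` modulo `t` and `d * t` modulo `a`; since
    -- `a` is coprime to both `d` and `t`, the lift is coprime to `t` and to `a`, hence to `f`.
    lift-coprime : ∀ {d f a} → ¬ (f ≈ 0#) → a ⟂ d → ∃ λ a' → a' ≈[ d ] a × a' ⟂ f
    lift-coprime {d} {f} {a} f≉0 a⟂d with degree-bound f
    ... | n , deg with coprimePart n a f deg f≉0
    ...   | t , t⟂a , coprime =
      a + d * t , (t , refl) , coprime (a + d * t)
        (⟂-resp-≈mod (d , +-congˡ (*-comm d t)) (⟂-sym t⟂a))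
        (⟂-resp-≈mod (1# , trans (+-comm a (d * t)) (+-congˡ (sym (*-identityʳ a))))
          (⟂-sym (⟂-* a⟂d (⟂-sym t⟂a))))

    lift-coprimes : ∀ {d f} → ¬ (f ≈ 0#) → ∀ {T} → All (_⟂ d) T →
      ∃ λ S → Pointwise (_≈[ d ]_) S T × All (_⟂ f) S
    lift-coprimes f≉0 [] = [] , [] , []
    lift-coprimes f≉0 (a⟂d ∷ T⟂d) =
      let a' , a'≈a , a'⟂f = lift-coprime f≉0 a⟂d
          S , S≈T , S⟂f = lift-coprimes f≉0 T⟂d
      in a' ∷ S , a'≈a ∷ S≈T , a'⟂f ∷ S⟂f

    module _ (e e⁻¹ w : Carrier) (ee⁻¹≈1 : e * e⁻¹ ≈ 1#) ([1+e]w≈1 : (1# + e) * w ≈ 1#) where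

      -- The kernel of U(R/f) → U(R/d) is nontrivial. With f = h d: if h and d are
      -- coprime, take u ≡ 1 mod d and u ≡ 1 + e mod h; otherwise h = g h' with g ∣ d, and u = 1 + d h' works.
      kernel-element : ∀ {g d f} → f ≈ g * d → ¬ (f ∣ d) → ¬ (f ≈ 0#) →
        ∃ λ u → u ⟂ f × u ≈[ d ] 1# × ¬ (u ≈[ f ] 1#)
      kernel-element {h} {d} {f} f≈hd f∤d f≉0 with coprime-or-cofactor d h h≉0
        where
        h≉0 : ¬ (h ≈ 0#)
        h≉0 h≈0 = f≉0 (trans f≈hd (trans (*-congʳ h≈0) (zeroˡ d)))
      ... | inj₁ (k , l , dk+hl≈1) =
        1# + d * (k * e) , u⟂f , (k * e , refl) , u≉1
        where
        u = 1# + d * (k * e)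

        u⟂h : u ⟂ h
        -- Adding `h * (l * e)` turns `u` into 1 + (d k + h l) e = 1 + e, whose inverse is `w`.
        u⟂h = w , l * e * w , (begin
          u * w + h * (l * e * w)          ≈⟨ solve 7 (λ o d k e w h l → (o :+ d :* (k :* e)) :* w :+ h :* (l :* e :* w) := (o :+ (d :* k :+ h :* l) :* e) :* w) refl 1# d k e w h l ⟩
          (1# + (d * k + h * l) * e) * w   ≈⟨ *-congʳ (+-congˡ (trans (*-congʳ dk+hl≈1) (*-identityˡ e))) ⟩
          (1# + e) * w                     ≈⟨ [1+e]w≈1 ⟩
          1#                               ∎)

        u⟂f : u ⟂ f
        u⟂f = ⟂-∣ (1# , trans (*-identityˡ f) f≈hd) (⟂-* u⟂h (⟂-resp-≈mod (k * e , refl) 1⟂))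

        u≉1 : ¬ (u ≈[ f ] 1#)
        -- If `f` divides u - 1 = d k e, it divides d k d because `e` is invertible. It also divides
        -- h l d, and the two sum to (d k + h l) d = d.
        u≉1 (m , u≈1+fm) = f∤d (m * e⁻¹ * d + l * e * e⁻¹ , (begin
          (m * e⁻¹ * d + l * e * e⁻¹) * f                      ≈⟨ solve 6 (λ m e' d l e f → (m :* e' :* d :+ l :* e :* e') :* f := f :* m :* (e' :* d) :+ l :* e :* e' :* f) refl m e⁻¹ d l e f ⟩
          f * m * (e⁻¹ * d) + l * e * e⁻¹ * f                  ≈⟨ +-cong (*-congʳ (+-cancelˡ 1# _ _ (sym u≈1+fm))) (*-congˡ f≈hd) ⟩
          d * (k * e) * (e⁻¹ * d) + l * e * e⁻¹ * (h * d)      ≈⟨ solve 6 (λ d k e e' l h → d :* (k :* e) :* (e' :* d) :+ l :* e :* e' :* (h :* d) := (d :* k :+ h :* l) :* (e :* e' :* d)) refl d k e e⁻¹ l h ⟩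
          (d * k + h * l) * (e * e⁻¹ * d)                      ≈⟨ *-cong dk+hl≈1 (*-congʳ ee⁻¹≈1) ⟩
          1# * (1# * d)                                        ≈⟨ trans (*-identityˡ _) (*-identityˡ d) ⟩
          d                                                    ∎))
      ... | inj₂ (h' , (g , h≈gh' , g∣d , h∤h') , _) =
        1# + d * h' , u⟂f , (h' , refl) , u≉1
        where
        u = 1# + d * h'

        u⟂d : u ⟂ d
        u⟂d = ⟂-resp-≈mod (h' , refl) 1⟂

        u⟂h : u ⟂ h
        u⟂h = ⟂-∣ (1# , trans (*-identityˡ h) h≈gh')
          (⟂-* (⟂-∣ g∣d u⟂d) (⟂-resp-≈mod (d , +-congˡ (*-comm d h')) 1⟂))

        u⟂f : u ⟂ f
        u⟂f = ⟂-∣ (1# , trans (*-identityˡ f) f≈hd) (⟂-* u⟂h u⟂d)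

        u≉1 : ¬ (u ≈[ f ] 1#)
        -- Here u - 1 = d h', so divisibility by f = h d would, after cancelling `d`, make `h`
        -- divide `h'`.
        u≉1 (m , u≈1+fm) = h∤h' (m , trans (*-comm m h) (sym (cancelˡ d≉0 (begin
          d * h'        ≈⟨ +-cancelˡ 1# _ _ u≈1+fm ⟩
          f * m         ≈⟨ *-congʳ f≈hd ⟩
          h * d * m     ≈⟨ solve 3 (λ h d m → h :* d :* m := d :* (h :* m)) refl h d m ⟩
          d * (h * m)   ∎))))
          where
          d≉0 : ¬ (d ≈ 0#)
          d≉0 d≈0 = f≉0 (trans f≈hd (trans (*-congˡ d≈0) (zeroʳ h)))

      -- Modulo `d` the term `u` is 1, so a reduction of `u ∷ S` can be read as one of `S`, unless
      -- it drops exactly `u`. That exception would give ∏ S = u ∏ S modulo `f`, and cancelling the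
      -- unit ∏ S contradicts the choice of `u`.
      cofactor-reducible : ∀ {g d f u S} → f ≈ g * d → u ≈[ d ] 1# → ¬ (u ≈[ f ] 1#) →
        All (_⟂ f) S → Reducible f (u ∷ S) → Reducible d S
      cofactor-reducible {g} {d} {f} {u} {S} f≈gd u≈1 u≉1 S⟂f = drop-u
        where
        d∣f : d ∣ f
        d∣f = g , sym f≈gd

        u*≈ : ∀ x → u * x ≈[ d ] x
        u*≈ x = ≈mod-trans (≈mod-*-cong u≈1 (≈⇒≈mod refl)) (≈⇒≈mod (*-identityˡ x))

        full : ∀ {T'} → T' ⊆ S → length T' ≡ length S → ¬ (∏ T' ≈[ f ] u * ∏ S)
        full {T'} sub ∣T'∣≡∣S∣ eq = u≉1 (≈mod-sym (*-cancelˡ-mod (∏-⟂ S⟂f) (≈mod-trans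
          (≈⇒≈mod (*-identityʳ (∏ S)))
          (≈mod-trans ∏S≈∏T' (≈mod-trans eq (≈⇒≈mod (*-comm u (∏ S))))))))
          where
          ∏S≈∏T' : ∏ S ≈[ f ] ∏ T'
          ∏S≈∏T' = ≈mod-sym (∏-cong-mod (Pointwise.map (λ { ≡.refl → ≈⇒≈mod refl })
            (toPointwise ∣T'∣≡∣S∣ sub)))

        drop-u : Reducible f (u ∷ S) → Reducible d S
        drop-u (T' , (_ ∷ʳ sub) , s≤s ∣T'∣≤∣S∣ , eq) with ℕ.m≤n⇒m<n∨m≡n ∣T'∣≤∣S∣
        ... | inj₁ ∣T'∣<∣S∣ = T' , sub , ∣T'∣<∣S∣ , ≈mod-trans (≈mod-∣ d∣f eq) (u*≈ (∏ S))
        ... | inj₂ ∣T'∣≡∣S∣ = ⊥-elim (full sub ∣T'∣≡∣S∣ eq)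
        drop-u (_ ∷ T' , (≡.refl ∷ sub) , s≤s ∣T'∣<∣S∣ , eq) =
          T' , sub , ∣T'∣<∣S∣ ,
          ≈mod-trans (≈mod-sym (u*≈ (∏ T'))) (≈mod-trans (≈mod-∣ d∣f eq) (u*≈ (∏ S)))

      -- D(U(R/f)) > D(U(R/d)): lift a sequence of units mod d to units mod f and adjoin a kernel element.
      allReducible-cofactor : ∀ {g d f n} → f ≈ g * d → ¬ (f ∣ d) → ¬ (f ≈ 0#) →
        AllReducibleFrom f (_⟂ f) (suc n) → AllReducibleFrom d (_⟂ d) n
      allReducible-cofactor f≈gd f∤d f≉0 red T T⟂d n≤∣T∣ =
        let u , u⟂f , u≈1 , u≉1 = kernel-element f≈gd f∤d f≉0
            S , S≈T , S⟂f = lift-coprimes f≉0 T⟂d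
            ∣S∣≡∣T∣ = Pointwise.Pointwise-length S≈T
        in reducible-resp-≈mod S≈T (cofactor-reducible f≈gd u≈1 u≉1 S⟂f
             (red (u ∷ S) (u⟂f ∷ S⟂f) (s≤s (≡.subst (_ ℕ.≤_) (≡.sym ∣S∣≡∣T∣) n≤∣T∣))))

      -- The modulus and the bound `n` vary along the induction: removing a term costs one in the
      -- length, and passing to the cofactor gains one in the bound, so `n ≤ m` persists.
      reducible : ∀ m n f → ¬ (f ≈ 0#) → AllReducibleFrom f (_⟂ f) n →
        ∀ T → length T ≡ m → n ℕ.≤ m → Reducible f T
      reducible m n f f≉0 red T ∣T∣≡m n≤m with decide (λ a → coprime-or-cofactor a f f≉0) T
      ... | inj₁ T⟂f = red T T⟂f (≡.subst (n ℕ.≤_) (≡.sym ∣T∣≡m) n≤m)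
      -- The bound 0 is impossible, as the empty sequence has no proper subsequence; so `n` has a
      -- predecessor.
      reducible m zero f f≉0 red T ∣T∣≡m n≤m | inj₂ _ with red [] [] z≤n
      ... | _ , _ , () , _
      reducible (suc m) (suc n) f f≉0 red T ∣T∣≡m (s≤s n≤m) | inj₂ any =
        let a , T₀ , (f' , (g , f≈gf' , (q , qg≈a) , f∤f') , _) , len , ∏T≈a∏T₀ , insert = extract any
            f'≉0 = λ f'≈0 → f≉0 (trans f≈gf' (trans (*-congˡ f'≈0) (zeroʳ g)))
            f∣af' = q , trans (*-congˡ f≈gf') (trans (sym (*-assoc q g f')) (*-congʳ qg≈a))
            T' , sub , ∣T'∣<∣T₀∣ , ∏T'≈∏T₀ = reducible m n f' f'≉0
              (allReducible-cofactor f≈gf' f∤f' f≉0 red) T₀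
              (ℕ.suc-injective (≡.trans (≡.sym len) ∣T∣≡m)) n≤m
            T⁺ , sub⁺ , len⁺ , ∏T⁺≈a∏T' = insert sub
        in T⁺ , sub⁺ , ≡.subst₂ ℕ._<_ (≡.sym len⁺) (≡.sym len) (s≤s ∣T'∣<∣T₀∣) ,
           ≈mod-trans (≈⇒≈mod ∏T⁺≈a∏T') (≈mod-trans (*-scale-mod f∣af' ∏T'≈∏T₀) (≈⇒≈mod (sym ∏T≈a∏T₀)))

-- Coefficient lists as a commutative ring

module PolynomialRing {c ℓ} (K : CommutativeRing c ℓ) where
  open CommutativeRing K
  open RingProperties ring using (-0#≈0#)
  open Poly K

  coeff : Pol → ℕ → Carrier
  coeff [] n = 0#
  coeff (a ∷ p) zero = a
  coeff (a ∷ p) (suc n) = coeff p n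

  -- Lists differing by trailing zeros denote the same polynomial.
  infix 4 _≋_
  record _≋_ (p q : Pol) : Set ℓ where
    constructor coeffwise
    field at : ∀ n → coeff p n ≈ coeff q n
  open _≋_ public

  coeff-⊕ : ∀ p q n → coeff (p ⊕ q) n ≈ coeff p n + coeff q n
  coeff-⊕ [] q n = sym (+-identityˡ _)
  coeff-⊕ (a ∷ p) [] n = sym (+-identityʳ _)
  coeff-⊕ (a ∷ p) (b ∷ q) zero = refl
  coeff-⊕ (a ∷ p) (b ∷ q) (suc n) = coeff-⊕ p q n

  coeff-neg : ∀ p n → coeff (neg p) n ≈ - coeff p n
  coeff-neg [] n = sym -0#≈0#
  coeff-neg (a ∷ p) zero = refl
  coeff-neg (a ∷ p) (suc n) = coeff-neg p n

  coeff-scale : ∀ a p n → coeff (scale a p) n ≈ a * coeff p n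
  coeff-scale a [] n = sym (zeroʳ a)
  coeff-scale a (b ∷ p) zero = refl
  coeff-scale a (b ∷ p) (suc n) = coeff-scale a p n

  private
    rawGroup : RawGroup c ℓ
    rawGroup = record { Carrier = Pol ; _≈_ = _≋_ ; _∙_ = _⊕_ ; ε = zeroP ; _⁻¹ = neg }

    module Coefficients = AbelianGroup (PointwiseConstruct.abelianGroup ℕ +-abelianGroup)

  -- `coeff` embeds lists into the pointwise group of functions on ℕ, injectively by the very
  -- definition of `_≋_`; the axioms are pulled back along it.
  ⊕-isAbelianGroup : IsAbelianGroup _≋_ _⊕_ zeroP neg
  ⊕-isAbelianGroup = GroupMonomorphism.isAbelianGroup {G₁ = rawGroup} {G₂ = Coefficients.rawGroup} {⟦_⟧ = coeff}
    (record
      { isGroupHomomorphism = record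
        { isMonoidHomomorphism = record
          { isMagmaHomomorphism = record
            { isRelHomomorphism = record { cong = at }
            ; homo = coeff-⊕
            }
          ; ε-homo = λ _ → refl
          }
        ; ⁻¹-homo = coeff-neg
        }
      ; injective = coeffwise
      })
    Coefficients.isAbelianGroup

  ⊕-abelianGroup : AbelianGroup c ℓ
  ⊕-abelianGroup = record { isAbelianGroup = ⊕-isAbelianGroup }

  private
    module ⊕ = AbelianGroup ⊕-abelianGroup
  open CommutativeSemigroupProperties ⊕.commutativeSemigroup using (interchange; x∙yz≈y∙xz)
  open SetoidReasoning ⊕.setoid

  ∷-cong : ∀ {a b p q} → a ≈ b → p ≋ q → a ∷ p ≋ b ∷ q
  ∷-cong a≈b p≋q .at zero = a≈b
  ∷-cong a≈b p≋q .at (suc n) = at p≋q n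

  0∷[]≋[] : 0# ∷ [] ≋ []
  0∷[]≋[] .at zero = refl
  0∷[]≋[] .at (suc n) = refl

  0∷-⊕ : ∀ p q → 0# ∷ (p ⊕ q) ≋ (0# ∷ p) ⊕ (0# ∷ q)
  0∷-⊕ p q = ∷-cong (sym (+-identityˡ 0#)) ⊕.refl

  scale-cong : ∀ {a b p q} → a ≈ b → p ≋ q → scale a p ≋ scale b q
  scale-cong {a} {b} {p} {q} a≈b p≋q .at n =
    trans (coeff-scale a p n) (trans (*-cong a≈b (at p≋q n)) (sym (coeff-scale b q n)))

  scale-zeroˡ : ∀ {a} p → a ≈ 0# → scale a p ≋ []
  scale-zeroˡ {a} p a≈0 .at n = trans (coeff-scale a p n) (trans (*-congʳ a≈0) (zeroˡ _))

  scale-1 : ∀ p → scale 1# p ≋ p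
  scale-1 p .at n = trans (coeff-scale 1# p n) (*-identityˡ _)

  scale-⊕ : ∀ a p q → scale a (p ⊕ q) ≋ scale a p ⊕ scale a q
  scale-⊕ a p q .at n =
    trans (coeff-scale a (p ⊕ q) n) (trans (*-congˡ (coeff-⊕ p q n)) (trans (distribˡ a _ _)
      (sym (trans (coeff-⊕ (scale a p) (scale a q) n) (+-cong (coeff-scale a p n) (coeff-scale a q n))))))

  scale-scale : ∀ a b p → scale (a * b) p ≋ scale a (scale b p)
  scale-scale a b p .at n =
    trans (coeff-scale (a * b) p n) (trans (*-assoc a b _)
      (sym (trans (coeff-scale a (scale b p) n) (*-congˡ (coeff-scale b p n)))))

  ∷≋[]⇒tail≋[] : ∀ {a p} → a ∷ p ≋ [] → p ≋ []
  ∷≋[]⇒tail≋[] a∷p≋[] .at n = at a∷p≋[] (suc n)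

  ⊗-zeroˡ : ∀ {p} q → p ≋ [] → p ⊗ q ≋ []
  ⊗-zeroˡ {[]} q p≋[] = ⊕.refl
  ⊗-zeroˡ {a ∷ p} q p≋[] = begin
    scale a q ⊕ (0# ∷ (p ⊗ q))  ≈⟨ ⊕.∙-cong (scale-zeroˡ q (at p≋[] 0)) (∷-cong refl (⊗-zeroˡ q (∷≋[]⇒tail≋[] p≋[]))) ⟩
    [] ⊕ (0# ∷ [])              ≈⟨ 0∷[]≋[] ⟩
    []                          ∎

  ⊗-zeroʳ : ∀ p → p ⊗ [] ≋ []
  ⊗-zeroʳ [] = ⊕.refl
  ⊗-zeroʳ (a ∷ p) = ⊕.trans (∷-cong refl (⊗-zeroʳ p)) 0∷[]≋[]

  -- Equal polynomials may be lists of different lengths. Once one list is exhausted the other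
  -- consists of zeros, and `⊗-zeroˡ` takes over.
  ⊗-cong : ∀ {p p' q q'} → p ≋ p' → q ≋ q' → p ⊗ q ≋ p' ⊗ q'
  ⊗-cong {[]} {p'} {q} {q'} p≋p' q≋q' = ⊕.sym (⊗-zeroˡ q' (⊕.sym p≋p'))
  ⊗-cong {a ∷ p} {[]} {q} {q'} p≋p' q≋q' = ⊗-zeroˡ q p≋p'
  ⊗-cong {a ∷ p} {b ∷ p'} {q} {q'} p≋p' q≋q' = ⊕.∙-cong
    (scale-cong (at p≋p' 0) q≋q')
    (∷-cong refl (⊗-cong {p} {p'} (coeffwise (λ n → at p≋p' (suc n))) q≋q'))

  -- The mirror image of the recursion defining `_⊗_`; commutativity and the division step both rest
  -- on it.
  ⊗-∷ʳ : ∀ p b q → p ⊗ (b ∷ q) ≋ scale b p ⊕ (0# ∷ (p ⊗ q))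
  ⊗-∷ʳ [] b q = ⊕.sym 0∷[]≋[]
  ⊗-∷ʳ (a ∷ p) b q = ∷-cong (+-congʳ (*-comm a b)) (begin
    scale a q ⊕ (p ⊗ (b ∷ q))                      ≈⟨ ⊕.∙-congˡ (⊗-∷ʳ p b q) ⟩
    scale a q ⊕ (scale b p ⊕ (0# ∷ (p ⊗ q)))       ≈⟨ x∙yz≈y∙xz (scale a q) (scale b p) _ ⟩
    scale b p ⊕ (scale a q ⊕ (0# ∷ (p ⊗ q)))       ∎)

  ⊗-comm : ∀ p q → p ⊗ q ≋ q ⊗ p
  ⊗-comm [] q = ⊕.sym (⊗-zeroʳ q)
  ⊗-comm (a ∷ p) q = begin
    scale a q ⊕ (0# ∷ (p ⊗ q))  ≈⟨ ⊕.∙-congˡ (∷-cong refl (⊗-comm p q)) ⟩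
    scale a q ⊕ (0# ∷ (q ⊗ p))  ≈⟨ ⊗-∷ʳ q a p ⟨
    q ⊗ (a ∷ p)                 ∎

  ⊗-distribˡ-⊕ : ∀ p q r → p ⊗ (q ⊕ r) ≋ (p ⊗ q) ⊕ (p ⊗ r)
  ⊗-distribˡ-⊕ [] q r = ⊕.refl
  ⊗-distribˡ-⊕ (a ∷ p) q r = begin
    scale a (q ⊕ r) ⊕ (0# ∷ (p ⊗ (q ⊕ r)))                            ≈⟨ ⊕.∙-cong (scale-⊕ a q r) (∷-cong refl (⊗-distribˡ-⊕ p q r)) ⟩
    (scale a q ⊕ scale a r) ⊕ (0# ∷ ((p ⊗ q) ⊕ (p ⊗ r)))              ≈⟨ ⊕.∙-congˡ (0∷-⊕ (p ⊗ q) (p ⊗ r)) ⟩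
    (scale a q ⊕ scale a r) ⊕ ((0# ∷ (p ⊗ q)) ⊕ (0# ∷ (p ⊗ r)))       ≈⟨ interchange (scale a q) (scale a r) _ _ ⟩
    (scale a q ⊕ (0# ∷ (p ⊗ q))) ⊕ (scale a r ⊕ (0# ∷ (p ⊗ r)))       ∎

  ⊗-distribʳ-⊕ : ∀ p q r → (q ⊕ r) ⊗ p ≋ (q ⊗ p) ⊕ (r ⊗ p)
  ⊗-distribʳ-⊕ p q r = begin
    (q ⊕ r) ⊗ p            ≈⟨ ⊗-comm (q ⊕ r) p ⟩
    p ⊗ (q ⊕ r)            ≈⟨ ⊗-distribˡ-⊕ p q r ⟩
    (p ⊗ q) ⊕ (p ⊗ r)      ≈⟨ ⊕.∙-cong (⊗-comm p q) (⊗-comm p r) ⟩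
    (q ⊗ p) ⊕ (r ⊗ p)      ∎

  0∷-⊗ : ∀ p q → (0# ∷ p) ⊗ q ≋ 0# ∷ (p ⊗ q)
  0∷-⊗ p q = ⊕.∙-congʳ (scale-zeroˡ q refl)

  scale-⊗ : ∀ a p q → scale a p ⊗ q ≋ scale a (p ⊗ q)
  scale-⊗ a [] q = ⊕.refl
  scale-⊗ a (b ∷ p) q = begin
    scale (a * b) q ⊕ (0# ∷ (scale a p ⊗ q))               ≈⟨ ⊕.∙-cong (scale-scale a b q) (∷-cong (sym (zeroʳ a)) (scale-⊗ a p q)) ⟩
    scale a (scale b q) ⊕ scale a (0# ∷ (p ⊗ q))           ≈⟨ scale-⊕ a (scale b q) (0# ∷ (p ⊗ q)) ⟨
    scale a (scale b q ⊕ (0# ∷ (p ⊗ q)))                   ∎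

  ⊗-assoc : ∀ p q r → (p ⊗ q) ⊗ r ≋ p ⊗ (q ⊗ r)
  ⊗-assoc [] q r = ⊕.refl
  ⊗-assoc (a ∷ p) q r = begin
    (scale a q ⊕ (0# ∷ (p ⊗ q))) ⊗ r                ≈⟨ ⊗-distribʳ-⊕ r (scale a q) (0# ∷ (p ⊗ q)) ⟩
    (scale a q ⊗ r) ⊕ ((0# ∷ (p ⊗ q)) ⊗ r)          ≈⟨ ⊕.∙-cong (scale-⊗ a q r) (0∷-⊗ (p ⊗ q) r) ⟩
    scale a (q ⊗ r) ⊕ (0# ∷ ((p ⊗ q) ⊗ r))          ≈⟨ ⊕.∙-congˡ (∷-cong refl (⊗-assoc p q r)) ⟩
    scale a (q ⊗ r) ⊕ (0# ∷ (p ⊗ (q ⊗ r)))          ∎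

  ⊗-identityˡ : ∀ p → oneP ⊗ p ≋ p
  ⊗-identityˡ p = begin
    scale 1# p ⊕ (0# ∷ [])  ≈⟨ ⊕.∙-cong (scale-1 p) 0∷[]≋[] ⟩
    p ⊕ []                  ≈⟨ ⊕.identityʳ p ⟩
    p                       ∎

  polynomialRing : CommutativeRing c ℓ
  polynomialRing = record
    { Carrier = Pol
    ; _≈_ = _≋_
    ; _+_ = _⊕_
    ; _*_ = _⊗_
    ; -_ = neg
    ; 0# = zeroP
    ; 1# = oneP
    ; isCommutativeRing = record
      { isRing = record
        { +-isAbelianGroup = ⊕-isAbelianGroup
        ; *-cong = ⊗-cong
        ; *-assoc = ⊗-assoc
        ; *-identity = ⊗-identityˡ , λ p → ⊕.trans (⊗-comm p oneP) (⊗-identityˡ p)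
        ; distrib = ⊗-distribˡ-⊕ , ⊗-distribʳ-⊕
        }
      ; *-comm = ⊗-comm
      }
    }

  ≋[]⇒IsZero : ∀ {p} → p ≋ [] → IsZero p
  ≋[]⇒IsZero {[]} p≋[] = []
  ≋[]⇒IsZero {a ∷ p} p≋[] = at p≋[] 0 ∷ ≋[]⇒IsZero (∷≋[]⇒tail≋[] p≋[])

  IsZero⇒≋[] : ∀ {p} → IsZero p → p ≋ []
  IsZero⇒≋[] [] = ⊕.refl
  IsZero⇒≋[] (a≈0 ∷ p≈0) = ⊕.trans (∷-cong a≈0 (IsZero⇒≋[] p≈0)) 0∷[]≋[]

  open AbelianGroupProperties ⊕-abelianGroup using (x∙y⁻¹≈ε⇒x≈y; x≈y⇒x∙y⁻¹≈ε)

  IsZero-⊕neg⇒≋ : ∀ {p q} → IsZero (p ⊕ neg q) → p ≋ q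
  IsZero-⊕neg⇒≋ p-q≈0 = x∙y⁻¹≈ε⇒x≈y _ _ (IsZero⇒≋[] p-q≈0)

  ≋⇒IsZero-⊕neg : ∀ {p q} → p ≋ q → IsZero (p ⊕ neg q)
  ≋⇒IsZero-⊕neg p≋q = ≋[]⇒IsZero (x≈y⇒x∙y⁻¹≈ε p≋q)

-- Polynomials over a finite field: degrees, division, gcd

avoid-two : ∀ {q} → 2 < q → (i j : Fin q) → ∃ λ k → k ≢ i × k ≢ j
avoid-two (s≤s (s≤s (s≤s z≤n))) zero zero = suc zero , (λ ()) , (λ ())
avoid-two (s≤s (s≤s (s≤s z≤n))) zero (suc zero) = suc (suc zero) , (λ ()) , (λ ())
avoid-two (s≤s (s≤s (s≤s z≤n))) zero (suc (suc _)) = suc zero , (λ ()) , (λ ())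
avoid-two (s≤s (s≤s (s≤s z≤n))) (suc zero) zero = suc (suc zero) , (λ ()) , (λ ())
avoid-two (s≤s (s≤s (s≤s z≤n))) (suc (suc _)) zero = suc zero , (λ ()) , (λ ())
avoid-two (s≤s (s≤s (s≤s z≤n))) (suc _) (suc _) = zero , (λ ()) , (λ ())

module FieldPolynomials {c ℓ q} (F : FiniteField c ℓ q) where
  open FiniteField F
  open RingProperties ring using (+-inverseʳ-unique)
  open Poly cring
  open PolynomialRing cring
  private
    module R = CommutativeRing polynomialRing
    module PR = RingProperties R.ring
  open SemiringDivisibility R.semiring using (_∣_; _,_)
  open Modular polynomialRing

  -- The enumeration reduces equality to that of indices; this makes degrees computable.
  ≈? : ∀ x y → Dec (x ≈ y)
  ≈? x y with enum-surj x | enum-surj y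
  ... | i , ei≈x | j , ej≈y with i Fin.≟ j
  ...   | yes ≡.refl = yes (trans (sym ei≈x) ej≈y)
  ...   | no i≢j = no λ x≈y → i≢j (enum-inj i j (trans ei≈x (trans x≈y (sym ej≈y))))

  avoid-values : 2 < q → ∀ x y → ∃ λ z → ¬ (z ≈ x) × ¬ (z ≈ y)
  avoid-values 2<q x y with enum-surj x | enum-surj y
  ... | i , ei≈x | j , ej≈y with avoid-two 2<q i j
  ...   | k , k≢i , k≢j = enum k ,
          (λ ek≈x → k≢i (enum-inj k i (trans ek≈x (sym ei≈x)))) ,
          (λ ek≈y → k≢j (enum-inj k j (trans ek≈y (sym ej≈y))))

  *-nonzero : ∀ {x y} → ¬ (x ≈ 0#) → ¬ (y ≈ 0#) → ¬ (x * y ≈ 0#)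
  *-nonzero {x} {y} x≉0 y≉0 xy≈0 with inverse x x≉0
  ... | x⁻¹ , xx⁻¹≈1 = y≉0 (begin
    y                ≈⟨ *-identityʳ y ⟨
    y * 1#           ≈⟨ *-congˡ xx⁻¹≈1 ⟨
    y * (x * x⁻¹)    ≈⟨ *-assoc y x x⁻¹ ⟨
    (y * x) * x⁻¹    ≈⟨ *-congʳ (trans (*-comm y x) xy≈0) ⟩
    0# * x⁻¹         ≈⟨ zeroˡ x⁻¹ ⟩
    0#               ∎)
    where open SetoidReasoning setoid

  degree< : ℕ → Pol → Set ℓ
  degree< n p = ∀ m → n ℕ.≤ m → coeff p m ≈ 0#

  record HasDegree (p : Pol) (n : ℕ) : Set ℓ where
    constructor _,_
    field
      leading≉0 : ¬ (coeff p n ≈ 0#)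
      bounded   : degree< (suc n) p

  degree<0⇒≋[] : ∀ {p} → degree< 0 p → p ≋ []
  degree<0⇒≋[] deg .at n = deg n z≤n

  degree<-length : ∀ p → degree< (length p) p
  degree<-length [] m _ = refl
  degree<-length (a ∷ p) (suc m) (s≤s len≤m) = degree<-length p m len≤m

  degree<-pred : ∀ {p n} → degree< (suc n) p → coeff p n ≈ 0# → degree< n p
  degree<-pred {p} {n} deg p[n]≈0 m n≤m with ℕ.m≤n⇒m<n∨m≡n n≤m
  ... | inj₁ n<m = deg m n<m
  ... | inj₂ ≡.refl = p[n]≈0

  degree<-mono : ∀ {p m n} → m ℕ.≤ n → degree< m p → degree< n p
  degree<-mono m≤n deg k n≤k = deg k (ℕ.≤-trans m≤n n≤k)

  HasDegree-resp : ∀ {p r n} → p ≋ r → HasDegree p n → HasDegree r n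
  HasDegree-resp p≋r (p[n]≉0 , deg) =
    (λ r[n]≈0 → p[n]≉0 (trans (at p≋r _) r[n]≈0)) , λ m n<m → trans (sym (at p≋r m)) (deg m n<m)

  HasDegree⇒≉ : ∀ {p n} → HasDegree p n → ¬ (p ≋ [])
  HasDegree⇒≉ (p[n]≉0 , _) p≋[] = p[n]≉0 (at p≋[] _)

  HasDegree-< : ∀ {p m n} → HasDegree p m → degree< n p → m < n
  HasDegree-< (p[m]≉0 , _) deg = ℕ.≰⇒> λ n≤m → p[m]≉0 (deg _ n≤m)

  degree : ∀ p → p ≋ [] ⊎ ∃ (HasDegree p)
  degree p = go (length p) (degree<-length p)
    where
    go : ∀ n → degree< n p → p ≋ [] ⊎ ∃ (HasDegree p)
    go zero deg = inj₁ (degree<0⇒≋[] deg)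
    go (suc n) deg with ≈? (coeff p n) 0#
    ... | yes p[n]≈0 = go n (degree<-pred {p} deg p[n]≈0)
    ... | no p[n]≉0 = inj₂ (n , p[n]≉0 , deg)

  nonzero⇒HasDegree : ∀ {p} → ¬ (p ≋ []) → ∃ (HasDegree p)
  nonzero⇒HasDegree {p} p≉[] with degree p
  ... | inj₁ p≋[] = ⊥-elim (p≉[] p≋[])
  ... | inj₂ deg = deg

  coeff-∷-⊗ : ∀ a p g n → coeff ((a ∷ p) ⊗ g) (suc n) ≈ a * coeff g (suc n) + coeff (p ⊗ g) n
  coeff-∷-⊗ a p g n = trans (coeff-⊕ (scale a g) (0# ∷ (p ⊗ g)) (suc n)) (+-congʳ (coeff-scale a g (suc n)))

  -- Beyond position `n` the summand `scale a g` vanishes, so there the coefficients of (a + x p) g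
  -- are those of p g shifted by one.
  HasDegree-⊗ : ∀ {p g m n} → HasDegree p m → HasDegree g n → HasDegree (p ⊗ g) (m ℕ.+ n)
  HasDegree-⊗ {[]} (0≉0 , _) _ = ⊥-elim (0≉0 refl)
  HasDegree-⊗ {a ∷ p} {g} {zero} {n} (a≉0 , deg) (g[n]≉0 , deg') =
    HasDegree-resp (R.sym ap*g≋ag)
      ((λ ag[n]≈0 → *-nonzero a≉0 g[n]≉0 (trans (sym (coeff-scale a g n)) ag[n]≈0)) ,
       λ m n<m → trans (coeff-scale a g m) (trans (*-congˡ (deg' m n<m)) (zeroʳ a)))
    where
    ap*g≋ag : (a ∷ p) ⊗ g ≋ scale a g
    ap*g≋ag = R.trans
      (R.+-congˡ {scale a g} (R.trans (∷-cong refl (⊗-zeroˡ {p} g (degree<0⇒≋[] λ m _ → deg (suc m) (s≤s z≤n)))) 0∷[]≋[]))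
      (R.+-identityʳ (scale a g))
  HasDegree-⊗ {a ∷ p} {g} {suc m} {n} (p[m]≉0 , deg) g-degree@(_ , deg') =
    let pg[m+n]≉0 , pg-deg = HasDegree-⊗ {p} {g} {m} {n} (p[m]≉0 , λ k m<k → deg (suc k) (s≤s m<k)) g-degree
    in (λ eq → pg[m+n]≉0 (trans (sym (shift (m ℕ.+ n) (ℕ.m≤n+m n m))) eq)) ,
       λ { (suc k) (s≤s m+n<k) → trans (shift k (ℕ.≤-trans (ℕ.m≤n+m n m) (ℕ.<⇒≤ m+n<k))) (pg-deg k m+n<k) }
    where
    shift : ∀ k → n ℕ.≤ k → coeff ((a ∷ p) ⊗ g) (suc k) ≈ coeff (p ⊗ g) k
    shift k n≤k = trans (coeff-∷-⊗ a p g k)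
      (trans (+-congʳ (trans (*-congˡ (deg' (suc k) (s≤s n≤k))) (zeroʳ a))) (+-identityˡ _))

  -- Degrees add, so `d` times a nonzero difference cannot vanish.
  cancelˡ : ∀ {d x y} → ¬ (d ≋ []) → d ⊗ x ≋ d ⊗ y → x ≋ y
  cancelˡ {d} {x} {y} d≉[] dx≋dy with degree (x ⊕ neg y)
  ... | inj₁ x-y≋[] = PR.x∙y⁻¹≈ε⇒x≈y x y x-y≋[]
  ... | inj₂ (n , x-y-degree) with nonzero⇒HasDegree d≉[]
  ...   | m , d-degree = ⊥-elim (HasDegree⇒≉ (HasDegree-⊗ {d} d-degree x-y-degree)
          (R.trans (PR.x[y-z]≈xy-xz d x y) (PR.x≈y⇒x∙y⁻¹≈ε dx≋dy)))

  division : ∀ {f n} → HasDegree f n → ∀ a → ∃₂ λ s r → a ≋ (f ⊗ s) ⊕ r × degree< n r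
  division {f} _ [] = [] , [] , R.sym (R.trans (R.+-identityʳ _) (⊗-zeroʳ f)) , λ _ _ → refl
  division {f} {n} f-degree@(f[n]≉0 , f-deg) (a ∷ p)
    with division {f} f-degree p | inverse (coeff f n) f[n]≉0
  ... | s , r , p≋fs+r , r-deg | w , f[n]w≈1 = t ∷ s , r' , ap≋f[ts]+r' , r'-deg
    where
    -- From p = f s + r follows a + x p = f (x s) + (a + x r). The new remainder may have degree
    -- exactly `n`, and subtracting `t` times `f` removes that coefficient; for `n` = 0 it is `a`
    -- itself.
    t = coeff (a ∷ r) n * w
    r' = (a ∷ r) ⊕ neg (scale t f)

    ap≋f[ts]+r' : a ∷ p ≋ (f ⊗ (t ∷ s)) ⊕ r'
    ap≋f[ts]+r' = R.sym (begin
      (f ⊗ (t ∷ s)) ⊕ r'                                                 ≈⟨ R.+-congʳ {r'} (⊗-∷ʳ f t s) ⟩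
      (scale t f ⊕ (0# ∷ (f ⊗ s))) ⊕ ((a ∷ r) ⊕ neg (scale t f))         ≈⟨ R.+-assoc (scale t f ⊕ (0# ∷ (f ⊗ s))) (a ∷ r) (neg (scale t f)) ⟨
      ((scale t f ⊕ (0# ∷ (f ⊗ s))) ⊕ (a ∷ r)) ⊕ neg (scale t f)         ≈⟨ R.+-congʳ {neg (scale t f)} (R.+-assoc (scale t f) (0# ∷ (f ⊗ s)) (a ∷ r)) ⟩
      (scale t f ⊕ ((0# ∷ (f ⊗ s)) ⊕ (a ∷ r))) ⊕ neg (scale t f)         ≈⟨ xyx⁻¹≈y (scale t f) ((0# ∷ (f ⊗ s)) ⊕ (a ∷ r)) ⟩
      (0# ∷ (f ⊗ s)) ⊕ (a ∷ r)                                           ≈⟨ ∷-cong (+-identityˡ a) (R.sym p≋fs+r) ⟩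
      a ∷ p                                                              ∎)
      where
      open SetoidReasoning R.setoid
      open AbelianGroupProperties R.+-abelianGroup using (xyx⁻¹≈y)

    coeff-r' : ∀ m → coeff r' m ≈ coeff (a ∷ r) m - t * coeff f m
    coeff-r' m = trans (coeff-⊕ (a ∷ r) (neg (scale t f)) m)
      (+-congˡ (trans (coeff-neg (scale t f) m) (-‿cong (coeff-scale t f m))))

    tf[n]≈ : t * coeff f n ≈ coeff (a ∷ r) n
    tf[n]≈ = trans (*-assoc (coeff (a ∷ r) n) w (coeff f n))
      (trans (*-congˡ (trans (*-comm w (coeff f n)) f[n]w≈1)) (*-identityʳ _))

    r'-deg : degree< n r'
    r'-deg = degree<-pred {r'}
      (λ { m@(suc k) (s≤s n≤k) → trans (coeff-r' m) (trans
             (+-cong (r-deg k n≤k) (-‿cong (trans (*-congˡ (f-deg m (s≤s n≤k))) (zeroʳ t))))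
             (-‿inverseʳ 0#)) })
      (trans (coeff-r' n) (trans (+-congˡ (-‿cong tf[n]≈)) (-‿inverseʳ _)))

  -- Euclid's algorithm with a degree bound as fuel: if the coefficient at `n` vanishes the bound
  -- drops, otherwise `b` has degree exactly `n` and the remainder has smaller degree.
  bézout : ∀ n b → degree< n b → ∀ a → ∃ (Bézout a b)
  bézout zero b deg a = a , bézout-zero (degree<0⇒≋[] deg)
  bézout (suc n) b deg a with ≈? (coeff b n) 0#
  ... | yes b[n]≈0 = bézout n b (degree<-pred {b} deg b[n]≈0) a
  ... | no b[n]≉0 =
    let s , r , a≋bs+r , r-deg = division {b} (b[n]≉0 , deg) a
        g , bézout-br = bézout n r r-deg b
    in g , bézout-step a≋bs+r bézout-br

  constant-unit : ∀ {x y} → x * y ≈ 1# → (x ∷ []) ⊗ (y ∷ []) ≋ oneP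
  constant-unit xy≈1 = ∷-cong (trans (+-identityʳ _) xy≈1) R.refl

  degree0-unit : ∀ {g} → HasDegree g 0 → ∃ λ w → g ⊗ w ≋ oneP
  degree0-unit {[]} (0≉0 , _) = ⊥-elim (0≉0 refl)
  degree0-unit {x ∷ p} (x≉0 , deg) with inverse x x≉0
  ... | y , xy≈1 = y ∷ [] , R.trans
    (⊗-cong {x ∷ p} {x ∷ []} {y ∷ []} (∷-cong refl (degree<0⇒≋[] λ m _ → deg (suc m) (s≤s z≤n))) R.refl)
    (constant-unit xy≈1)

  -- With deg s = m, deg f = m + k + 1 > m. This gives both the descent and `¬ (f ∣ s)`, as a
  -- nonzero multiple of `f` has at least the degree of `f`.
  proper-cofactor : ∀ {a f g s k} → ¬ (f ≋ []) → s ⊗ g ≋ f → g ∣ a → HasDegree g (suc k) →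
    ProperCofactor a f s × (∀ n → degree< (suc n) f → degree< n s)
  proper-cofactor {a} {f} {g} {s} {k} f≉[] sg≋f g∣a g-degree
    with nonzero⇒HasDegree (λ s≋[] → f≉[] (R.trans (R.sym sg≋f) (⊗-zeroˡ g s≋[])))
  ... | m , s-degree@(_ , s-deg) =
    (g , R.trans (R.sym sg≋f) (⊗-comm s g) , g∣a , f∤s) ,
    λ n f-deg → degree<-mono {s} (ℕ.≤-trans m<m+1+k (ℕ.s≤s⁻¹ (HasDegree-< {f} f-degree f-deg))) s-deg
    where
    f-degree : HasDegree f (m ℕ.+ suc k)
    f-degree = HasDegree-resp sg≋f (HasDegree-⊗ {s} s-degree g-degree)

    m<m+1+k : m < m ℕ.+ suc k
    m<m+1+k = ℕ.m<m+n m (s≤s z≤n)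

    f∤s : ¬ (f ∣ s)
    f∤s (t , tf≋s) with degree t
    ... | inj₁ t≋[] = HasDegree⇒≉ {s} s-degree (R.trans (R.sym tf≋s) (⊗-zeroˡ f t≋[]))
    ... | inj₂ (j , t-degree) = ℕ.<-irrefl ≡.refl (ℕ.≤-trans
            (HasDegree-< {s} (HasDegree-resp tf≋s (HasDegree-⊗ {t} t-degree f-degree)) s-deg)
            (ℕ.≤-trans m<m+1+k (ℕ.m≤n+m _ j)))

  coprime-or-cofactor : ∀ a f → ¬ (f ≋ []) →
    a ⟂ f ⊎ (∃ λ f' → ProperCofactor a f f' × (∀ n → degree< (suc n) f → degree< n f'))
  coprime-or-cofactor a f f≉[] with bézout (length f) f (degree<-length f) a
  ... | g , bz@(g∣a , (s , sg≋f) , _) with degree g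
  ...   | inj₁ g≋[] = ⊥-elim (f≉[] (R.trans (R.sym sg≋f) (R.trans (⊗-cong {s} R.refl g≋[]) (⊗-zeroʳ s))))
  ...   | inj₂ (zero , g-degree) = let w , gw≋1 = degree0-unit g-degree in inj₁ (bézout-unit {a} {f} {g} gw≋1 bz)
  ...   | inj₂ (suc k , g-degree) = inj₂ (s , proper-cofactor f≉[] sg≋f g∣a g-degree)

  -- Any constant other than 0 and -1 serves as `e`; a third field element is what `2 < q` provides.
  consecutive-units : 2 < q → ∃ λ e → ∃₂ λ e⁻¹ w → e ⊗ e⁻¹ ≋ oneP × (oneP ⊕ e) ⊗ w ≋ oneP
  consecutive-units 2<q with avoid-values 2<q 0# (- 1#)
  ... | x , x≉0 , x≉-1 with inverse x x≉0 | inverse (1# + x) (λ 1+x≈0 → x≉-1 (+-inverseʳ-unique 1# x 1+x≈0))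
  ...   | y , xy≈1 | z , [1+x]z≈1 = x ∷ [] , y ∷ [] , z ∷ [] , constant-unit xy≈1 , constant-unit [1+x]z≈1

  -- Translation to `EqMod` and conclusion

  EqMod⇒≈mod : ∀ {f a b} → EqMod f a b → a ≈[ f ] b
  EqMod⇒≈mod {f} (h , fh-[a-b]≈0) = -⇒≈mod {f} {h} (IsZero-⊕neg⇒≋ fh-[a-b]≈0)

  ≈mod⇒EqMod : ∀ {f a b} → a ≈[ f ] b → EqMod f a b
  ≈mod⇒EqMod {f} a≈b = map₂ ≋⇒IsZero-⊕neg (≈mod⇒- {f} a≈b)

  module D (f : Pol) = Davenport (EqMod f) _⊗_ oneP

  allReducible : 2 < q → ∀ f → ¬ IsZero f → ∀ {n} →
    D.AllReducibleFrom f (IsUnitMod f) n → D.AllReducibleFrom f (λ _ → ⊤ {ℓ}) n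
  allReducible 2<q f f≉0 {n} red T _ n≤∣T∣ =
    let e , e⁻¹ , w , ee⁻¹≋1 , [1+e]w≋1 = consecutive-units 2<q
        T' , sub , len , eq = reducible degree< degree<0⇒≋[]
          (λ p → length p , degree<-length p) cancelˡ coprime-or-cofactor e e⁻¹ w ee⁻¹≋1 [1+e]w≋1
          (length T) n f (λ f≋[] → f≉0 (≋[]⇒IsZero f≋[])) red' T ≡.refl n≤∣T∣
    in T' , sub , len , ≈mod⇒EqMod {f} eq
    where
    red' : AllReducibleFrom f (_⟂ f) n
    red' S S⟂f n≤∣S∣ =
      let S' , sub , len , eq = red S (All.map (λ {a} a⟂f → map₂ (≈mod⇒EqMod {f}) (⟂⇒unitMod {f} {a} a⟂f)) S⟂f) n≤∣S∣
      in S' , sub , len , EqMod⇒≈mod {f} eq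

theorem1p1 : ∀ {c ℓ : Level} (q : ℕ) → IsPrimePower q → 2 < q → (F : FiniteField c ℓ q) →
    let open Poly (FiniteField.cring F) in
    (f : Pol) → ¬ EqMod f oneP zeroP → ¬ IsZero f →
    ∀ (n : ℕ) → Davenport.IsDavenport (EqMod f) _⊗_ oneP (λ _ → ⊤ {ℓ}) n
    ⇔ Davenport.IsDavenport (EqMod f) _⊗_ oneP (IsUnitMod f) n
theorem1p1 q _ 2<q F f _ f≉0 n = mk⇔
  -- Both the bound and its minimality are statements about `AllReducibleFrom`, so its equivalence
  -- for the two predicates at every length transfers them together.
  (λ (red , minimal) → restrict red , λ m m<n red' → minimal m m<n (extend red'))
  (λ (red , minimal) → extend red , λ m m<n red' → minimal m m<n (restrict red'))
  where
  open FieldPolynomials F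
  open Poly (FiniteField.cring F)

  extend : ∀ {m} → D.AllReducibleFrom f (IsUnitMod f) m → D.AllReducibleFrom f (λ _ → ⊤) m
  extend = allReducible 2<q f f≉0

  restrict : ∀ {m} → D.AllReducibleFrom f (λ _ → ⊤) m → D.AllReducibleFrom f (IsUnitMod f) m
  restrict red T _ = red T (universal (λ _ → tt) T)
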